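{- Let $n\ge 1$ be an integer, let $q$ be a prime power, let $\mathcal{C}\subseteq \mathrm{U}(n,\mathbb{F}_q)$ be a linear flag-rank-metric code with minimum distance $\delta=3$, and let $\alpha$ be its codimension. Then $\mathcal{C}$ is perfect if and only if \[ n=\frac{q^\alpha-1}{q-1}. \] Moreover, necessarily $\alpha\ge \delta$ (that is, $\alpha\ge 3$).
   Context: $\mathbb{F}_q$ is the finite field with $q$ elements. $\mathrm{U}(n,\mathbb{F}_q)$ is the $\mathbb{F}_q$-vector space of $n\times n$ upper triangular matrices over $\mathbb{F}_q$; it has dimension $\frac{n(n+1)}{2}$. For $M\in \mathrm{U}(n,\mathbb{F}_q)$ and $1\le i\le n$, $M_{[i]}$ is the $i\times(n-i+1)$ submatrix of $M$ obtained by deleting the first $i-1$ columns and the last $n-i$ rows (i.e. rows $1,\dots,i$ and columns $i,\dots,n$). The flag-rank weight of $M$ is $\mathrm{fr}(M)=\sum_{i=1}^{n}\mathrm{rk}(M_{[i]})$; the flag-rank distance is $\mathrm{d}_{\mathrm{fr}}(A,B)=\mathrm{fr}(A-B)$. A linear flag-rank-metric code is an $\mathbb{F}_q$-subspace $\mathcal{C}$ of $\mathrm{U}(n,\mathbb{F}_q)$; its minimum (flag-rank) distance, defined when $\mathcal{C}\neq\{\boldsymbol{0}\}$, is $\delta=\min\{\mathrm{fr}(M):M\in\mathcal{C}\setminus\{\boldsymbol{0}\}\}$. Its codimension is $\frac{n(n+1)}{2}-\dim_{\mathbb{F}_q}(\mathcal{C})$. Let $b_q(n,t)=|\{A\in \mathrm{U}(n,\mathbb{F}_q):\mathrm{fr}(A)\le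 t\}|$. A code $\mathcal{C}$ with minimum distance $\delta$ is perfect if $|\mathcal{C}|\,b_q(n,t)=q^{\frac{n(n+1)}{2}}$, where $t=\left\lfloor\frac{\delta-1}{2}\right\rfloor$. -}

module Defs where

open import Level using (Level; suc; _⊔_)
open import Algebra.Apartness.Bundles using (HeytingField; HeytingCommutativeRing)
open import Algebra.Bundles using (CommutativeRing; Ring)
import Algebra.Construct.Pointwise as Pointwise
open import Algebra.Module.Bundles using (LeftModule)
import Algebra.Module.Construct.TensorUnit as TensorUnit
import Algebra.Properties.CommutativeMonoid.Sum as Sum
open import Data.Fin.Base as Fin using (Fin; toℕ; _↑ʳ_; cast; inject≤)
open import Data.Fin.Properties using (toℕ<n; toℕ≤n)
open import Data.Nat.Base as ℕ using (ℕ; _*_; _∸_; _^_; _/_; _≤_; NonZero)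
open import Data.Nat.Properties as ℕ using (m+[n∸m]≡n)
open import Data.Nat.Primality using (Prime; prime⇒nonZero; prime⇒nonTrivial)
open import Data.Product.Base using (Σ; ∃; _×_; _,_; proj₁)
open import Data.Vec.Functional using (Vector; transpose)
open import Function.Bundles using (Inverse)
open import Relation.Binary.Bundles using (Setoid)
import Relation.Binary.Construct.On as On
open import Relation.Binary.PropositionalEquality as ≡ using (_≡_)
open import Relation.Unary using (Pred; _∈_; _⊆_)

private
  variable
    a s ℓs p : Level

IsPrimePower : ℕ → Set
IsPrimePower q = ∃ λ p → ∃ λ k → Prime p × 1 ≤ k × q ≡ p ^ k

primePower⇒q∸1-nonZero : ∀ {q} → IsPrimePower q → NonZero (q ∸ 1)
primePower⇒q∸1-nonZero (p , ℕ.suc k , p-prime , _ , ≡.refl) =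
  ℕ.>-nonZero (ℕ.m<n⇒0<n∸m (ℕ.<-≤-trans 1<p p≤p^[1+k]))
  where
  instance
    p≢0 = prime⇒nonZero p-prime
    p^k≢0 = ℕ.m^n≢0 p k
  1<p : 1 ℕ.< p
  1<p = ℕ.nonTrivial⇒n>1 p {{prime⇒nonTrivial p-prime}}
  p≤p^[1+k] : p ≤ p ^ ℕ.suc k
  p≤p^[1+k] = ℕ.m≤m*n p (p ^ k)

-- Members of P are identified when their underlying elements are, whatever the
-- membership proofs.
HasCardinality : (S : Setoid s ℓs) → Pred (Setoid.Carrier S) p → ℕ → Set (s ⊔ ℓs ⊔ p)
HasCardinality S P k = Inverse (On.setoid {B = Σ (Setoid.Carrier S) P} S proj₁) (≡.setoid (Fin k))

-- The bijection with Fin q makes _≈_ and invertibility decidable, so a Heyting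
-- field of this kind is a field in the classical sense: every x ≉ 0# is
-- invertible, and 0# ≉ 1#.
record FiniteField c ℓ₁ ℓ₂ (q : ℕ) : Set (suc (c ⊔ ℓ₁ ⊔ ℓ₂)) where
  field
    heytingField : HeytingField c ℓ₁ ℓ₂

  open HeytingField heytingField using (heytingCommutativeRing)
  open CommutativeRing (HeytingCommutativeRing.commutativeRing heytingCommutativeRing) public

  field
    enumeration : Inverse setoid (≡.setoid (Fin q))

module _ {r ℓr m ℓm} {R : Ring r ℓr} (A : Set a) (V : LeftModule R m ℓm) where
  open LeftModule V

  pointwise : LeftModule R (a ⊔ m) (a ⊔ ℓm)
  pointwise = record
    { Carrierᴹ = A → Carrierᴹ
    ; _≈ᴹ_ = λ f g → ∀ x → f x ≈ᴹ g x
    ; _+ᴹ_ = λ f g x → f x +ᴹ g x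
    ; _*ₗ_ = λ k f x → k *ₗ f x
    ; 0ᴹ = λ _ → 0ᴹ
    ; -ᴹ_ = λ f x → -ᴹ f x
    ; isLeftModule = record
      { isLeftSemimodule = record
        { +ᴹ-isCommutativeMonoid = Pointwise.isCommutativeMonoid A +ᴹ-isCommutativeMonoid
        ; isPreleftSemimodule = record
          { *ₗ-cong = λ k f x → *ₗ-cong k (f x)
          ; *ₗ-zeroˡ = λ f x → *ₗ-zeroˡ (f x)
          ; *ₗ-distribʳ = λ f k l x → *ₗ-distribʳ (f x) k l
          ; *ₗ-identityˡ = λ f x → *ₗ-identityˡ (f x)
          ; *ₗ-assoc = λ k l f x → *ₗ-assoc k l (f x)
          ; *ₗ-zeroʳ = λ k x → *ₗ-zeroʳ k
          ; *ₗ-distribˡ = λ k f g x → *ₗ-distribˡ k (f x) (g x)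
          }
        }
      ; -ᴹ‿cong = λ f x → -ᴹ‿cong (f x)
      ; -ᴹ‿inverse = (λ f x → -ᴹ‿inverseˡ (f x)) , (λ f x → -ᴹ‿inverseʳ (f x))
      }
    }

module _ {r ℓr m ℓm} {R : Ring r ℓr} (V : LeftModule R m ℓm) where
  open Ring R using (Carrier; _≈_; 0#)
  open LeftModule V
  open Sum +ᴹ-commutativeMonoid using (sum)

  record Subspace p : Set (r ⊔ m ⊔ ℓm ⊔ suc p) where
    field
      Member    : Pred Carrierᴹ p
      resp-≈ᴹ   : ∀ {x y} → x ≈ᴹ y → x ∈ Member → y ∈ Member
      0ᴹ-closed : 0ᴹ ∈ Member
      +ᴹ-closed : ∀ {x y} → x ∈ Member → y ∈ Member → x +ᴹ y ∈ Member
      *ₗ-closed : ∀ k {x} → x ∈ Member → k *ₗ x ∈ Member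

  linearCombination : ∀ {k} → Vector Carrier k → Vector Carrierᴹ k → Carrierᴹ
  linearCombination c v = sum λ i → c i *ₗ v i

  Span : ∀ {k} → Vector Carrierᴹ k → Pred Carrierᴹ (r ⊔ ℓm)
  Span v x = ∃ λ c → linearCombination c v ≈ᴹ x

  LinearlyIndependent : ∀ {k} → Vector Carrierᴹ k → Set (r ⊔ ℓr ⊔ ℓm)
  LinearlyIndependent v = ∀ c → linearCombination c v ≈ᴹ 0ᴹ → ∀ i → c i ≈ 0#

  record IsBasis {k} (b : Vector Carrierᴹ k) (P : Pred Carrierᴹ p) : Set (r ⊔ ℓr ⊔ m ⊔ ℓm ⊔ p) where
    field
      members     : ∀ i → b i ∈ P
      independent : LinearlyIndependent b
      spanning    : P ⊆ Span b

  -- Dimensions (and the ranks, weights and distances below) are relations to ℕ: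
  -- the number in question is the unique d for which the relation holds.
  HasDimension : Pred Carrierᴹ p → ℕ → Set (r ⊔ ℓr ⊔ m ⊔ ℓm ⊔ p)
  HasDimension P d = ∃ λ (b : Vector Carrierᴹ d) → IsBasis b P

module FlagRank {c ℓ₁ ℓ₂ q} (F : FiniteField c ℓ₁ ℓ₂ q) where
  open FiniteField F using (_≈_; 0#; ring)
  open Sum ℕ.+-0-commutativeMonoid using (sum)

  vectorSpace : ℕ → LeftModule ring c ℓ₁
  vectorSpace n = pointwise (Fin n) TensorUnit.leftModule

  matrixSpace : ℕ → ℕ → LeftModule ring c ℓ₁
  matrixSpace m n = pointwise (Fin m) (vectorSpace n)

  Matrix : ℕ → ℕ → Set c
  Matrix m n = LeftModule.Carrierᴹ (matrixSpace m n)

  module _ {m n : ℕ} where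
    open LeftModule (matrixSpace m n) public
      using (_≉ᴹ_; 0ᴹ) renaming (≈ᴹ-setoid to matrixSetoid)

  Rank : ∀ {m n} → Matrix m n → ℕ → Set (c ⊔ ℓ₁)
  Rank {m} M = HasDimension (vectorSpace m) (Span (vectorSpace m) (transpose M))

  UpperTriangular : ∀ {n} → Pred (Matrix n n) ℓ₁
  UpperTriangular M = ∀ i j → j Fin.< i → M i j ≈ 0#

  -- With k counted from 0, this is rows 0, …, k and columns k, …, n - 1, i.e.
  -- M_[k+1] when rows and columns are counted from 1.
  _[_] : ∀ {n} → Matrix n n → (k : Fin n) → Matrix (ℕ.suc (toℕ k)) (n ∸ toℕ k)
  (M [ k ]) i j = M (inject≤ i (toℕ<n k)) (cast (m+[n∸m]≡n (toℕ≤n k)) (toℕ k ↑ʳ j))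

  FlagRankWeight : ∀ {n} → Matrix n n → ℕ → Set (c ⊔ ℓ₁)
  FlagRankWeight {n} M w = ∃ λ (rk : Vector ℕ n) → (∀ i → Rank (M [ i ]) (rk i)) × sum rk ≡ w

  Ball : ∀ n → ℕ → Pred (Matrix n n) (c ⊔ ℓ₁)
  Ball n t A = UpperTriangular A × ∃ λ w → FlagRankWeight A w × w ≤ t

  -- Membership is not assumed decidable, but it is as soon as the code has a
  -- dimension, the field being finite.
  record LinearCode n p : Set (c ⊔ ℓ₁ ⊔ suc p) where
    field
      subspace : Subspace (matrixSpace n n) p
    open Subspace subspace public
    field
      upperTriangular : Member ⊆ UpperTriangular

  module _ {n : ℕ} (C : LinearCode n p) where
    open LinearCode C using (Member)

    MinimumDistance : ℕ → Set (c ⊔ ℓ₁ ⊔ p)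
    MinimumDistance δ =
      (∃ λ M → M ∈ Member × M ≉ᴹ 0ᴹ × FlagRankWeight M δ) ×
      (∀ M → M ∈ Member → M ≉ᴹ 0ᴹ → ∀ w → FlagRankWeight M w → δ ≤ w)

    -- The subtraction never truncates, as C lies in a space of dimension n(n+1)/2.
    Codimension : ℕ → Set (c ⊔ ℓ₁ ⊔ p)
    Codimension α =
      ∃ λ d → HasDimension (matrixSpace n n) Member d × α ≡ n * ℕ.suc n / 2 ∸ d

    Perfect : Set (c ⊔ ℓ₁ ⊔ p)
    Perfect = ∃ λ δ → ∃ λ |C| → ∃ λ b →
      MinimumDistance δ ×
      HasCardinality matrixSetoid Member |C| ×
      HasCardinality matrixSetoid (Ball n ((δ ∸ 1) / 2)) b ×
      |C| * b ≡ q ^ (n * ℕ.suc n / 2)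

{-# OPTIONS --safe #-}
module Submission where

-- A nonzero entry at (i , j) contributes to M_[k] for every k between i and j,
-- so the matrices of weight at most 1 are those with at most one nonzero entry,
-- on the diagonal, and the ball of radius t = 1 has 1 + n (q - 1) elements.
-- Since |C| = q^(N - α) with N = n (n + 1) / 2, perfection amounts to
-- 1 + n (q - 1) = q^α.
--
-- For α ≥ 3, upper triangular matrices supported on the top-left 2 × 2 block
-- have weight at most 2. Hence two codewords that agree outside this block are
-- equal, and C embeds into a space of dimension N - 3.

open import Defs
open import Algebra.Apartness.Bundles using (HeytingField)
open import Algebra.Bundles using (Ring)
open import Algebra.Module.Bundles using (LeftModule)
import Algebra.Module.Construct.TensorUnit as TensorUnit
import Algebra.Properties.CommutativeMonoid.Sum as Sum
open import Data.Fin.Base as Fin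
  using (Fin; zero; suc; toℕ; fromℕ<; inject≤; cast; _↑ʳ_; punchIn; punchOut; remQuot; combine; finToFun; funToFin)
open import Data.Fin.Properties as Fin using (any?; all?; toℕ<n; toℕ≤n)
open import Data.Nat.Base as ℕ using (ℕ; zero; suc; z≤n; s≤s; NonZero; _+_; _*_; _∸_; _^_; _/_; _≤_; _<_)
import Data.Nat.DivMod as ℕ
import Data.Nat.Properties as ℕ
open import Data.Nat.Tactic.RingSolver using (solve-∀)
open import Data.Product.Base using (∃; _×_; _,_; proj₁; proj₂)
open import Data.Vec.Functional using (Vector; _∷_; _++_; transpose; removeAt)
import Data.Vec.Functional.Relation.Binary.Pointwise.Properties as Pointwise
open import Function.Base using (_∘_; case_of_)
open import Function.Bundles using (_⇔_; mk⇔; Equivalence; Inverse; Injection)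
open import Function.Properties.Inverse using (Inverse⇒Injection) renaming (sym to inverse-sym; trans to inverse-trans)
open import Level using (Level)
open import Relation.Binary.Bundles using (Setoid)
open import Relation.Binary.Definitions using (Decidable; tri<; tri≈; tri>)
open import Relation.Binary.PropositionalEquality as ≡ using (_≡_; _≢_; module ≡-Reasoning)
import Relation.Binary.Reasoning.Setoid as ≈-Reasoning
open import Relation.Nullary using (¬_; Dec; yes; no; ¬?; contradiction; decidable-stable; _×-dec_)
open import Relation.Nullary.Decidable using (via-injection)
open import Relation.Unary using (Pred; _∈_; _⊆_)

-- Sums of natural numbers.

module ℕ-Sum = Sum ℕ.+-0-commutativeMonoid

term≤sum : ∀ {n} (t : Vector ℕ n) i → t i ≤ ℕ-Sum.sum t
term≤sum t zero    = ℕ.m≤m+n _ _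
term≤sum t (suc i) = ℕ.≤-trans (term≤sum (t ∘ suc) i) (ℕ.m≤n+m _ _)

-- Distinct indices with nonzero terms would already contribute 2. Applied below to the ranks of the
-- submatrices of a matrix of weight at most 1.
sum≤1⇒support-unique : ∀ {n} (t : Vector ℕ n) → ℕ-Sum.sum t ≤ 1 → ∀ {i j} → t i ≢ 0 → t j ≢ 0 → i ≡ j
sum≤1⇒support-unique {suc n} t Σt≤1 {i} {j} tᵢ≢0 tⱼ≢0 with i Fin.≟ j
... | yes i≡j = i≡j
... | no  i≢j = contradiction (begin
  2                                        ≤⟨ ℕ.+-mono-≤ (ℕ.n≢0⇒n>0 tᵢ≢0) (ℕ.n≢0⇒n>0 tⱼ≢0) ⟩
  t i + t j                                ≡⟨ ≡.cong (λ k → t i + t k) (Fin.punchIn-punchOut i≢j) ⟨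
  t i + removeAt t i (punchOut i≢j)        ≤⟨ ℕ.+-monoʳ-≤ (t i) (term≤sum (removeAt t i) _) ⟩
  t i + ℕ-Sum.sum (removeAt t i)           ≡⟨ ℕ-Sum.sum-remove t ⟨
  ℕ-Sum.sum t                              ≤⟨ Σt≤1 ⟩
  1                                        ∎) λ { (s≤s ()) }
  where open ℕ.≤-Reasoning

sum-support : ∀ {n} (t : Vector ℕ n) i → (∀ j → j ≢ i → t j ≡ 0) → ℕ-Sum.sum t ≡ t i
sum-support {suc n} t i t≡0 = begin
  ℕ-Sum.sum t                         ≡⟨ ℕ-Sum.sum-remove t ⟩
  t i + ℕ-Sum.sum (removeAt t i)      ≡⟨ ≡.cong (t i +_) (ℕ-Sum.sum-cong-≗ λ j → t≡0 _ (Fin.punchInᵢ≢i i j)) ⟩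
  t i + ℕ-Sum.sum {n} (λ _ → 0)       ≡⟨ ≡.cong (t i +_) (ℕ-Sum.sum-replicate-zero n) ⟩
  t i + 0                             ≡⟨ ℕ.+-identityʳ _ ⟩
  t i                                 ∎
  where open ≡-Reasoning

-- Triangular numbers and repunits.

triangular : ℕ → ℕ
triangular zero    = 0
triangular (suc n) = suc n + triangular n

-- The recursion follows the removal of the first row of an upper triangular matrix, the form in
-- which coordinates are counted below. Doubling first makes the division by 2 exact.
triangular≡n[1+n]/2 : ∀ n → triangular n ≡ n * suc n / 2
triangular≡n[1+n]/2 n = ≡.trans (≡.sym (ℕ.m*n/n≡m (triangular n) 2)) (≡.cong (_/ 2) (doubled n))
  where
  open ≡-Reasoning
  step : ∀ m → suc m * 2 + m * suc m ≡ suc m * suc (suc m)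
  step = solve-∀
  doubled : ∀ m → triangular m * 2 ≡ m * suc m
  doubled zero    = ≡.refl
  doubled (suc m) = begin
    (suc m + triangular m) * 2      ≡⟨ ℕ.*-distribʳ-+ 2 (suc m) (triangular m) ⟩
    suc m * 2 + triangular m * 2    ≡⟨ ≡.cong (suc m * 2 +_) (doubled m) ⟩
    suc m * 2 + m * suc m           ≡⟨ step m ⟩
    suc m * suc (suc m)             ∎

^-cancelʳ-≤ : ∀ m {n o} → 1 < m → m ^ n ≤ m ^ o → n ≤ o
^-cancelʳ-≤ m 1<m mⁿ≤mᵒ = ℕ.≮⇒≥ λ o<n → ℕ.<⇒≱ (ℕ.^-monoʳ-< m 1<m o<n) mⁿ≤mᵒ

-- The witness is 1 + q + ... + q^(α - 1) for q = `suc r`, built by Horner's rule. It shows that `r`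
-- divides q^α - 1, so that the quotient in the theorem is exact.
repunit : ∀ r α → ∃ λ g → suc r ^ α ≡ 1 + g * r
repunit r zero    = 0 , ≡.refl
repunit r (suc α) with g , eq ← repunit r α = 1 + g * suc r , (begin
  suc r * suc r ^ α         ≡⟨ ≡.cong (suc r *_) eq ⟩
  suc r * (1 + g * r)       ≡⟨ step r g ⟩
  1 + (1 + g * suc r) * r   ∎)
  where
  open ≡-Reasoning
  step : ∀ s h → suc s * (1 + h * s) ≡ 1 + (1 + h * suc s) * s
  step = solve-∀

perfect-arithmetic : ∀ n r α .{{_ : NonZero r}} → 1 + n * r ≡ suc r ^ α ⇔ n ≡ (suc r ^ α ∸ 1) / r
perfect-arithmetic n r α = mk⇔ to from
  where
  to : 1 + n * r ≡ suc r ^ α → n ≡ (suc r ^ α ∸ 1) / r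
  to eq = ≡.trans (≡.sym (ℕ.m*n/n≡m n r)) (≡.cong (λ x → (x ∸ 1) / r) eq)
  from : n ≡ (suc r ^ α ∸ 1) / r → 1 + n * r ≡ suc r ^ α
  -- The quotient alone does not determine the dividend; `repunit` supplies the zero remainder.
  from eq with g , e ← repunit r α = ≡.trans (≡.cong (λ x → 1 + x * r) n≡g) (≡.sym e)
    where
    n≡g : n ≡ g
    n≡g = ≡.trans eq (≡.trans (≡.cong (λ x → (x ∸ 1) / r) e) (ℕ.m*n/n≡m g r))

-- Finite cardinalities.

funToFin-cong : ∀ {m n} {f g : Fin m → Fin n} → (∀ i → f i ≡ g i) → funToFin f ≡ funToFin g
funToFin-cong {zero}  f≗g = ≡.refl
funToFin-cong {suc m} f≗g = ≡.cong₂ combine (f≗g zero) (funToFin-cong (f≗g ∘ suc))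

module _ {s ℓ p} (S : Setoid s ℓ) (P : Pred (Setoid.Carrier S) p) where
  open Setoid S

  -- The index is read off the membership proof; injectivity of `f` makes it independent of that
  -- proof, as a map out of the setoid of members requires.
  enumerated⇒hasCardinality : ∀ {k} (f : Fin k → Carrier) → (∀ i → f i ∈ P) →
    (∀ {i j} → f i ≈ f j → i ≡ j) → (∀ {x} → x ∈ P → ∃ λ i → f i ≈ x) → HasCardinality S P k
  enumerated⇒hasCardinality f f∈P injective surjective = record
    { to = λ (_ , x∈P) → proj₁ (surjective x∈P)
    ; from = λ i → f i , f∈P i
    ; to-cong = λ {(_ , x∈P)} {(_ , y∈P)} x≈y → injective
        (trans (proj₂ (surjective x∈P)) (trans x≈y (sym (proj₂ (surjective y∈P)))))
    ; from-cong = λ { ≡.refl → refl }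
    ; inverse = (λ {i} {(_ , x∈P)} x≈fi → injective (trans (proj₂ (surjective x∈P)) x≈fi))
              , (λ { {(_ , x∈P)} ≡.refl → proj₂ (surjective x∈P) })
    }

  hasCardinality-unique : ∀ {k l} → HasCardinality S P k → HasCardinality S P l → k ≡ l
  hasCardinality-unique I J = ℕ.≤-antisym (bound I J) (bound J I)
    where
    bound : ∀ {k l} → HasCardinality S P k → HasCardinality S P l → k ≤ l
    bound I J = Fin.injective⇒≤ (Injection.injective (Inverse⇒Injection (inverse-trans (inverse-sym I) J)))

-- Linear combinations and spans.

module LinearCombinations {r ℓr m ℓm} {R : Ring r ℓr} (V : LeftModule R m ℓm) where
  open Ring R using (1#; 0#; -_; -‿inverseˡ; -‿inverseʳ) renaming (Carrier to K; _≈_ to _≈ₖ_; _+_ to _+ₖ_; _*_ to _*ₖ_)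
  open LeftModule V
  open Sum +ᴹ-commutativeMonoid using (sum; sum-cong-≋; ∑-distrib-+)
  open ≈-Reasoning ≈ᴹ-setoid

  -- Subtraction as addition of a scalar multiple: that a `Subspace` contains differences then
  -- follows from `+ᴹ-closed` and `*ₗ-closed`.
  infixl 6 _⊖_
  _⊖_ : Carrierᴹ → Carrierᴹ → Carrierᴹ
  x ⊖ y = x +ᴹ (- 1#) *ₗ y

  x≈y⇒x⊖y≈0 : ∀ {x y} → x ≈ᴹ y → x ⊖ y ≈ᴹ 0ᴹ
  x≈y⇒x⊖y≈0 {x} {y} x≈y = begin
    x +ᴹ (- 1#) *ₗ y           ≈⟨ +ᴹ-congʳ (≈ᴹ-trans x≈y (≈ᴹ-sym (*ₗ-identityˡ y))) ⟩
    1# *ₗ y +ᴹ (- 1#) *ₗ y     ≈⟨ *ₗ-distribʳ y 1# (- 1#) ⟨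
    (1# +ₖ - 1#) *ₗ y          ≈⟨ *ₗ-congʳ (-‿inverseʳ 1#) ⟩
    0# *ₗ y                    ≈⟨ *ₗ-zeroˡ y ⟩
    0ᴹ                         ∎

  x⊖y≈0⇒x≈y : ∀ {x y} → x ⊖ y ≈ᴹ 0ᴹ → x ≈ᴹ y
  x⊖y≈0⇒x≈y {x} {y} x⊖y≈0 = begin
    x                                 ≈⟨ +ᴹ-identityʳ x ⟨
    x +ᴹ 0ᴹ                           ≈⟨ +ᴹ-congˡ (*ₗ-zeroˡ y) ⟨
    x +ᴹ 0# *ₗ y                      ≈⟨ +ᴹ-congˡ (*ₗ-congʳ (-‿inverseˡ 1#)) ⟨
    x +ᴹ (- 1# +ₖ 1#) *ₗ y            ≈⟨ +ᴹ-congˡ (*ₗ-distribʳ y (- 1#) 1#) ⟩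
    x +ᴹ ((- 1#) *ₗ y +ᴹ 1# *ₗ y)     ≈⟨ +ᴹ-assoc _ _ _ ⟨
    x ⊖ y +ᴹ 1# *ₗ y                  ≈⟨ +ᴹ-cong x⊖y≈0 (*ₗ-identityˡ y) ⟩
    0ᴹ +ᴹ y                           ≈⟨ +ᴹ-identityˡ y ⟩
    y                                 ∎

  lc : ∀ {k} → Vector K k → Vector Carrierᴹ k → Carrierᴹ
  lc = linearCombination V

  lc-cong : ∀ {k} {c d : Vector K k} (v : Vector Carrierᴹ k) → (∀ i → c i ≈ₖ d i) → lc c v ≈ᴹ lc d v
  lc-cong v c≈d = sum-cong-≋ λ i → *ₗ-congʳ (c≈d i)

  lc-+ : ∀ {k} (c d : Vector K k) v → lc c v +ᴹ lc d v ≈ᴹ lc (λ i → c i +ₖ d i) v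
  lc-+ c d v = begin
    lc c v +ᴹ lc d v                    ≈⟨ ∑-distrib-+ (λ i → c i *ₗ v i) (λ i → d i *ₗ v i) ⟨
    sum (λ i → c i *ₗ v i +ᴹ d i *ₗ v i) ≈⟨ sum-cong-≋ (λ i → *ₗ-distribʳ (v i) (c i) (d i)) ⟨
    lc (λ i → c i +ₖ d i) v             ∎

  lc-* : ∀ {k} a (c : Vector K k) v → a *ₗ lc c v ≈ᴹ lc (λ i → a *ₖ c i) v
  lc-* {zero}  a c v = *ₗ-zeroʳ a
  lc-* {suc k} a c v = begin
    a *ₗ (c zero *ₗ v zero +ᴹ lc (c ∘ suc) (v ∘ suc))        ≈⟨ *ₗ-distribˡ a _ _ ⟩
    a *ₗ c zero *ₗ v zero +ᴹ a *ₗ lc (c ∘ suc) (v ∘ suc)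
      ≈⟨ +ᴹ-cong (≈ᴹ-sym (*ₗ-assoc a (c zero) (v zero))) (lc-* a (c ∘ suc) (v ∘ suc)) ⟩
    lc (λ i → a *ₖ c i) v                                    ∎

  lc-zero : ∀ {k} (v : Vector Carrierᴹ k) → lc (λ _ → 0#) v ≈ᴹ 0ᴹ
  lc-zero {zero}  v = ≈ᴹ-refl
  lc-zero {suc k} v = ≈ᴹ-trans (+ᴹ-cong (*ₗ-zeroˡ (v zero)) (lc-zero (v ∘ suc))) (+ᴹ-identityˡ 0ᴹ)

  generator∈Span : ∀ {k} (v : Vector Carrierᴹ k) j → v j ∈ Span V v
  generator∈Span v zero = 1# ∷ (λ _ → 0#) , (begin
    1# *ₗ v zero +ᴹ lc (λ _ → 0#) (v ∘ suc)   ≈⟨ +ᴹ-cong (*ₗ-identityˡ (v zero)) (lc-zero (v ∘ suc)) ⟩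
    v zero +ᴹ 0ᴹ                              ≈⟨ +ᴹ-identityʳ (v zero) ⟩
    v zero                                    ∎)
  generator∈Span v (suc j) with c , c·v≈vⱼ ← generator∈Span (v ∘ suc) j = 0# ∷ c , (begin
    0# *ₗ v zero +ᴹ lc c (v ∘ suc)   ≈⟨ +ᴹ-cong (*ₗ-zeroˡ (v zero)) c·v≈vⱼ ⟩
    0ᴹ +ᴹ v (suc j)                  ≈⟨ +ᴹ-identityˡ _ ⟩
    v (suc j)                        ∎)

  lc-closed : ∀ {p k} (W : Subspace V p) (let open Subspace W) c {v : Vector Carrierᴹ k} →
    (∀ i → v i ∈ Member) → lc c v ∈ Member
  lc-closed {k = zero}  W c v∈W = Subspace.0ᴹ-closed W
  lc-closed {k = suc k} W c v∈W = +ᴹ-closed (*ₗ-closed (c zero) (v∈W zero)) (lc-closed W (c ∘ suc) (v∈W ∘ suc))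
    where open Subspace W

  spanSubspace : ∀ {k} → Vector Carrierᴹ k → Subspace V _
  spanSubspace v = record
    { Member    = Span V v
    ; resp-≈ᴹ   = λ x≈y (c , c·v≈x) → c , ≈ᴹ-trans c·v≈x x≈y
    ; 0ᴹ-closed = (λ _ → 0#) , lc-zero v
    ; +ᴹ-closed = λ (c , c·v≈x) (d , d·v≈y) → _ , ≈ᴹ-trans (≈ᴹ-sym (lc-+ c d v)) (+ᴹ-cong c·v≈x d·v≈y)
    ; *ₗ-closed = λ a (c , c·v≈x) → _ , ≈ᴹ-trans (≈ᴹ-sym (lc-* a c v)) (*ₗ-congˡ c·v≈x)
    }

  -- A span is closed under linear combinations, so checking generators suffices. The rank
  -- computations below thereby reduce to statements about single columns.
  Span-minimal : ∀ {k l} {u : Vector Carrierᴹ k} {v : Vector Carrierᴹ l} → (∀ j → u j ∈ Span V v) → Span V u ⊆ Span V v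
  Span-minimal {v = v} u∈v (c , c·u≈x) = Subspace.resp-≈ᴹ (spanSubspace v) c·u≈x (lc-closed (spanSubspace v) c u∈v)

module _ {r ℓr m ℓm} {R : Ring r ℓr} (V : LeftModule R m ℓm) where
  open Ring R using () renaming (_≈_ to _≈ₖ_)
  open LeftModule V
  open LinearCombinations V
  open LinearCombinations (TensorUnit.leftModule {R = R}) using () renaming (_⊖_ to _⊖ₖ_; x⊖y≈0⇒x≈y to x⊖y≈0⇒x≈yₖ)

  -- The coefficientwise difference is a relation among the `v i`; it is formed by `_⊖_` for the
  -- ring as a module over itself.
  independent⇒lc-injective : ∀ {k} {v : Vector Carrierᴹ k} → LinearlyIndependent V v →
    ∀ {c d} → lc c v ≈ᴹ lc d v → ∀ i → c i ≈ₖ d i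
  independent⇒lc-injective {v = v} independent {c} {d} c·v≈d·v i = x⊖y≈0⇒x≈yₖ (independent (λ i → c i ⊖ₖ d i) lc≈0 i)
    where
    lc≈0 : lc (λ i → c i ⊖ₖ d i) v ≈ᴹ 0ᴹ
    lc≈0 = ≈ᴹ-trans (≈ᴹ-sym (≈ᴹ-trans (+ᴹ-congˡ (lc-* _ d v)) (lc-+ c _ v))) (x≈y⇒x⊖y≈0 c·v≈d·v)

-- Inverses and counting over a finite field.

module FiniteFieldProperties {c ℓ₁ ℓ₂ q} (F : FiniteField c ℓ₁ ℓ₂ q) where
  open FiniteField F hiding (_+_; _*_; zero)
  open FiniteField F using () renaming (_*_ to _*ₖ_)
  open HeytingField heytingField using (_#_; tight; #⇒invertible)
  open Inverse enumeration using (to; from; to-cong; from-cong; strictlyInverseˡ; strictlyInverseʳ)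

  infix 4 _≈?_
  _≈?_ : Decidable _≈_
  _≈?_ = via-injection (Inverse⇒Injection enumeration) Fin._≟_

  from-injective : ∀ {i j} → from i ≈ from j → i ≡ j
  from-injective {i} {j} e = ≡.trans (≡.sym (strictlyInverseˡ i)) (≡.trans (to-cong e) (strictlyInverseˡ j))

  -- The inverse is sought among the finitely many field elements. If the search fails, x cannot be
  -- apart from 0, and tightness gives x ≈ 0.
  inverse : ∀ x → ¬ x ≈ 0# → ∃ λ y → y *ₖ x ≈ 1#
  inverse x x≉0 with any? (λ i → from i *ₖ x ≈? 1#)
  ... | yes (i , e) = from i , e
  ... | no  ∄y      = contradiction (proj₁ (tight x 0#) ¬x#0) x≉0
    where
    ¬x#0 : ¬ x # 0#
    ¬x#0 x#0 with y , y[x-0]≈1 , _ ← #⇒invertible x#0 = ∄y (to y , (begin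
      from (to y) *ₖ x     ≈⟨ *-cong (strictlyInverseʳ y) (sym x-0≈x) ⟩
      y *ₖ (x - 0#)        ≈⟨ y[x-0]≈1 ⟩
      1#                   ∎))
      where
      open ≈-Reasoning setoid
      x-0≈x : x - 0# ≈ x
      x-0≈x = trans (+-congˡ (trans (sym (+-identityˡ _)) (-‿inverseʳ 0#))) (+-identityʳ x)

  x*y≈0⇒x≈0 : ∀ {x y} → ¬ y ≈ 0# → x *ₖ y ≈ 0# → x ≈ 0#
  x*y≈0⇒x≈0 {x} {y} y≉0 xy≈0 with z , zy≈1 ← inverse y y≉0 = begin
    x                ≈⟨ *-identityʳ x ⟨
    x *ₖ 1#          ≈⟨ *-congˡ (trans (*-comm y z) zy≈1) ⟨
    x *ₖ (y *ₖ z)    ≈⟨ *-assoc x y z ⟨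
    x *ₖ y *ₖ z      ≈⟨ *-congʳ xy≈0 ⟩
    0# *ₖ z          ≈⟨ zeroˡ z ⟩
    0#               ∎
    where open ≈-Reasoning setoid

  vectorAt : ∀ {k} → Fin (q ^ k) → Vector Carrier k
  vectorAt i = from ∘ finToFun i

  indexOf : ∀ {k} → Vector Carrier k → Fin (q ^ k)
  indexOf v = funToFin (to ∘ v)

  vectorAt-indexOf : ∀ {k} (v : Vector Carrier k) i → vectorAt (indexOf v) i ≈ v i
  vectorAt-indexOf v i = trans (from-cong (Fin.finToFun-funToFin (to ∘ v) i)) (strictlyInverseʳ (v i))

  vectorAt-injective : ∀ {k} {i j : Fin (q ^ k)} → (∀ x → vectorAt {k} i x ≈ vectorAt {k} j x) → i ≡ j
  vectorAt-injective {k} {i} {j} e = ≡.trans (≡.sym (Fin.funToFin-finToFin {k} i))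
    (≡.trans (funToFin-cong {k} (from-injective ∘ e)) (Fin.funToFin-finToFin {k} j))

  indexOf-injective : ∀ {k} {v w : Vector Carrier k} → indexOf v ≡ indexOf w → ∀ i → v i ≈ w i
  indexOf-injective {v = v} {w} e i = trans (sym (vectorAt-indexOf v i))
    (trans (reflexive (≡.cong (λ x → vectorAt x i) e)) (vectorAt-indexOf w i))

  module _ {m ℓm p} {V : LeftModule ring m ℓm} (W : Subspace V p) {d}
    (dimension : HasDimension V (Subspace.Member W) d) where
    open LeftModule V
    open LinearCombinations V
    open Subspace W
    open IsBasis (proj₂ dimension)

    private
      element : Fin (q ^ d) → Carrierᴹ
      element i = lc (vectorAt i) (proj₁ dimension)

      element∈W : ∀ i → element i ∈ Member
      element∈W i = lc-closed W (vectorAt i) members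

      element-injective : ∀ {i j} → element i ≈ᴹ element j → i ≡ j
      element-injective e = vectorAt-injective {d} (independent⇒lc-injective V independent e)

    -- Coordinates with respect to the basis identify the subspace with the vectors of length `d`.
    dimension⇒cardinality : HasCardinality ≈ᴹ-setoid Member (q ^ d)
    dimension⇒cardinality = enumerated⇒hasCardinality ≈ᴹ-setoid Member element element∈W element-injective surjective
      where
      surjective : ∀ {x} → x ∈ Member → ∃ λ i → element i ≈ᴹ x
      surjective x∈W with c , c·b≈x ← spanning x∈W =
        indexOf c , ≈ᴹ-trans (lc-cong (proj₁ dimension) (vectorAt-indexOf c)) c·b≈x

    -- A count rather than a linear argument: separation turns `f` into an injection of `q ^ d`
    -- members into `q ^ k` vectors, and 1 < q lets the exponents be compared.
    dimension≤ : ∀ {k} → 1 < q → (f : Carrierᴹ → Vector Carrier k) →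
      (∀ {x y} → x ∈ Member → y ∈ Member → (∀ i → f x i ≈ f y i) → x ≈ᴹ y) → d ≤ k
    dimension≤ 1<q f separating = ^-cancelʳ-≤ q 1<q (Fin.injective⇒≤ {f = indexOf ∘ f ∘ element} λ {i} {j} e →
      element-injective (separating (element∈W i) (element∈W j) (indexOf-injective e)))

  open FlagRank F

  -- Matrices of rank at most one.

  module _ {m n} (M : Matrix m n) where
    open LinearCombinations (vectorSpace m)

    rank-zero : (∀ i j → M i j ≈ 0#) → Rank M 0
    rank-zero M≈0 = (λ ()) , record
      { members     = λ ()
      ; independent = λ _ _ ()
      ; spanning    = Span-minimal {v = λ ()} (λ j → (λ ()) , λ i → sym (M≈0 i j))
      }

    -- Each column lies in the span of an empty family, hence equals the empty sum.
    rank-zero⁻¹ : Rank M 0 → ∀ i j → M i j ≈ 0#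
    rank-zero⁻¹ (_ , basis) i j = sym (proj₂ (IsBasis.spanning basis (generator∈Span (transpose M) j)) i)

    module _ (j₀ : Fin n) (multiples : ∀ j → ∃ λ a → ∀ i → M i j ≈ a *ₖ M i j₀) where

      -- Column `j₀` alone spans the column space, and its nonzero entry in row `i` makes it
      -- independent.
      rank-one : ∀ i → ¬ M i j₀ ≈ 0# → Rank M 1
      rank-one i Mᵢⱼ≉0 = (λ _ → transpose M j₀) , record
        { members     = λ _ → generator∈Span (transpose M) j₀
        ; independent = λ { c c·b≈0 zero → x*y≈0⇒x≈0 Mᵢⱼ≉0 (trans (sym (+-identityʳ _)) (c·b≈0 i)) }
        ; spanning    = Span-minimal {v = λ _ → transpose M j₀} λ j → (λ _ → proj₁ (multiples j)) ,
                          λ i → trans (+-identityʳ _) (sym (proj₂ (multiples j) i))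
        }

      rank≤1 : ∃ λ r → Rank M r × r ≤ 1
      rank≤1 with any? (λ i → ¬? (M i j₀ ≈? 0#))
      ... | yes (i , Mᵢⱼ≉0) = 1 , rank-one i Mᵢⱼ≉0 , s≤s z≤n
      ... | no  ∄i          = 0 , rank-zero M≈0 , z≤n
        where
        M≈0 : ∀ i j → M i j ≈ 0#
        M≈0 i j = trans (proj₂ (multiples j) i)
          (trans (*-congˡ (decidable-stable (M i j₀ ≈? 0#) λ ne → ∄i (i , ne))) (zeroʳ _))

  row-rank≤1 : ∀ {n} (M : Matrix 1 n) → ∃ λ r → Rank M r × r ≤ 1
  row-rank≤1 M with any? (λ j → ¬? (M zero j ≈? 0#))
  ... | no  ∄j = 0 , rank-zero M (λ { zero j → decidable-stable (M zero j ≈? 0#) λ ne → ∄j (j , ne) }) , z≤n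
  ... | yes (j₀ , M₀ⱼ≉0) with y , yM≈1 ← inverse (M zero j₀) M₀ⱼ≉0 = rank≤1 M j₀ multiples
    where
    multiples : ∀ j → ∃ λ a → ∀ i → M i j ≈ a *ₖ M i j₀
    -- Division by the pivot `M zero j₀`, whose inverse is `y`.
    multiples j = M zero j *ₖ y , λ { zero →
      sym (trans (*-assoc _ _ _) (trans (*-congˡ yM≈1) (*-identityʳ _))) }

  -- The submatrices `A [ k ]` and the matrices of weight at most one.

  module _ {n} (k : Fin n) where

    -- The index maps inside `_[_]`: `(M [ k ]) i j` unfolds to
    -- `M (rowIndex k i) (columnIndex k j)`. The lemmas that follow identify their images with the
    -- rows up to `k` and the columns from `k` on.
    rowIndex : Fin (suc (toℕ k)) → Fin n
    rowIndex i = inject≤ i (toℕ<n k)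

    columnIndex : Fin (n ∸ toℕ k) → Fin n
    columnIndex j = cast (ℕ.m+[n∸m]≡n (toℕ≤n k)) (toℕ k ↑ʳ j)

    toℕ-columnIndex : ∀ j → toℕ (columnIndex j) ≡ toℕ k + toℕ j
    toℕ-columnIndex j = ≡.trans (Fin.toℕ-cast _ (toℕ k ↑ʳ j)) (Fin.toℕ-↑ʳ (toℕ k) j)

    rowIndex≤ : ∀ i → rowIndex i Fin.≤ k
    rowIndex≤ i = ≡.subst (_≤ toℕ k) (≡.sym (Fin.toℕ-inject≤ i _)) (ℕ.≤-pred (toℕ<n i))

    columnIndex≥ : ∀ j → k Fin.≤ columnIndex j
    columnIndex≥ j = ≡.subst (toℕ k ≤_) (≡.sym (toℕ-columnIndex j)) (ℕ.m≤m+n (toℕ k) _)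

    rowIndex-surjective : ∀ {i} → i Fin.≤ k → ∃ λ i' → rowIndex i' ≡ i
    rowIndex-surjective i≤k = fromℕ< (s≤s i≤k) ,
      Fin.toℕ-injective (≡.trans (Fin.toℕ-inject≤ _ _) (Fin.toℕ-fromℕ< _))

    columnIndex-surjective : ∀ {j} → k Fin.≤ j → ∃ λ j' → columnIndex j' ≡ j
    columnIndex-surjective {j} k≤j = fromℕ< (ℕ.∸-monoˡ-< (toℕ<n j) k≤j) ,
      Fin.toℕ-injective (≡.trans (toℕ-columnIndex _)
        (≡.trans (≡.cong (toℕ k +_) (Fin.toℕ-fromℕ< _)) (ℕ.m+[n∸m]≡n k≤j)))

  -- The condition i ≤ k ≤ j places the entry (i , j) inside `A [ k ]`, and rank 0 would force it to
  -- vanish.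
  submatrix-rank≢0 : ∀ {n} (A : Matrix n n) {i j k r} → ¬ A i j ≈ 0# → i Fin.≤ k → k Fin.≤ j → Rank (A [ k ]) r → r ≢ 0
  submatrix-rank≢0 A {k = k} Aᵢⱼ≉0 i≤k k≤j rank ≡.refl
    with i' , ≡.refl ← rowIndex-surjective k i≤k | j' , ≡.refl ← columnIndex-surjective k k≤j =
    Aᵢⱼ≉0 (rank-zero⁻¹ (A [ k ]) rank i' j')

  -- An entry at (i , j) makes both A [ i ] and A [ j ] nonzero.
  ball₁-diagonal : ∀ {n} {A : Matrix n n} → A ∈ Ball n 1 → ∀ {i j} → i ≢ j → A i j ≈ 0#
  ball₁-diagonal {A = A} (upper , _ , (rk , ranks , ≡.refl) , w≤1) {i} {j} i≢j with Fin.<-cmp i j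
  ... | tri≈ _ i≡j _ = contradiction i≡j i≢j
  ... | tri> _ _ j<i = upper i j j<i
  ... | tri< i<j _ _ = decidable-stable (A i j ≈? 0#) λ Aᵢⱼ≉0 → i≢j (sum≤1⇒support-unique rk w≤1
    (submatrix-rank≢0 A Aᵢⱼ≉0 ℕ.≤-refl (ℕ.<⇒≤ i<j) (ranks i))
    (submatrix-rank≢0 A Aᵢⱼ≉0 (ℕ.<⇒≤ i<j) ℕ.≤-refl (ranks j)))

  -- A nonzero diagonal entry at i makes the rank of `A [ i ]` nonzero, and weight at most 1 leaves
  -- room for only one such rank.
  ball₁-support-unique : ∀ {n} {A : Matrix n n} → A ∈ Ball n 1 → ∀ {i j} → ¬ A i i ≈ 0# → ¬ A j j ≈ 0# → i ≡ j
  ball₁-support-unique {A = A} (_ , _ , (rk , ranks , ≡.refl) , w≤1) {i} {j} Aᵢᵢ≉0 Aⱼⱼ≉0 = sum≤1⇒support-unique rk w≤1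
    (submatrix-rank≢0 A Aᵢᵢ≉0 ℕ.≤-refl ℕ.≤-refl (ranks i))
    (submatrix-rank≢0 A Aⱼⱼ≉0 ℕ.≤-refl ℕ.≤-refl (ranks j))

  -- Matrices with a single diagonal entry.

  single : ∀ {n} → Fin n → Carrier → Matrix n n
  single k x i j with i Fin.≟ k ×-dec j Fin.≟ k
  ... | yes _ = x
  ... | no  _ = 0#

  single-at : ∀ {n} (k : Fin n) x → single k x k k ≡ x
  single-at k x with k Fin.≟ k ×-dec k Fin.≟ k
  ... | yes _  = ≡.refl
  ... | no  ne = contradiction (≡.refl , ≡.refl) ne

  single-off : ∀ {n} {k : Fin n} {x i j} → ¬ (i ≡ k × j ≡ k) → single k x i j ≡ 0#
  single-off {k = k} {i = i} {j} off with i Fin.≟ k ×-dec j Fin.≟ k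
  ... | yes e = contradiction e off
  ... | no  _ = ≡.refl

  module _ {n} {k : Fin n} {x : Carrier} where

    -- The position (k , k) lies in the submatrix of index l only if k ≤ l ≤ k.
    single-rank≢ : ∀ {l} → l ≢ k → Rank (single k x [ l ]) 0
    single-rank≢ {l} l≢k = rank-zero (single k x [ l ]) λ i j → reflexive (single-off λ (i≡k , j≡k) →
      l≢k (Fin.≤-antisym (≡.subst (l Fin.≤_) j≡k (columnIndex≥ l j)) (≡.subst (Fin._≤ l) i≡k (rowIndex≤ l i))))

    single-rank≡ : ¬ x ≈ 0# → Rank (single k x [ k ]) 1
    single-rank≡ x≉0
      -- The positions of row `k` and column `k` inside the submatrix, all of whose other columns
      -- vanish.
      with i₀ , i₀↦k ← rowIndex-surjective k {k} ℕ.≤-refl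
         | j₀ , j₀↦k ← columnIndex-surjective k {k} ℕ.≤-refl =
      rank-one (single k x [ k ]) j₀ multiples i₀ λ e → x≉0 (trans (reflexive (≡.sym entry≡x)) e)
      where
      entry≡x : (single k x [ k ]) i₀ j₀ ≡ x
      entry≡x = ≡.trans (≡.cong₂ (single k x) i₀↦k j₀↦k) (single-at k x)
      multiples : ∀ j → ∃ λ a → ∀ i → (single k x [ k ]) i j ≈ a *ₖ (single k x [ k ]) i j₀
      multiples j = case columnIndex k j Fin.≟ k of λ where
        (yes j↦k) → 1# , λ i →
          trans (reflexive (≡.cong (single k x (rowIndex k i)) (≡.trans j↦k (≡.sym j₀↦k)))) (sym (*-identityˡ _))
        (no  j↦̸k) → 0# , λ i →
          trans (reflexive (single-off {k = k} {x} {rowIndex k i} (j↦̸k ∘ proj₂))) (sym (zeroˡ _))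

    single-weight : ¬ x ≈ 0# → FlagRankWeight (single k x) 1
    single-weight x≉0 = proj₁ ∘ ranks , proj₁ ∘ proj₂ ∘ ranks ,
      ≡.trans (sum-support (proj₁ ∘ ranks) k (λ l → proj₁ (proj₂ (proj₂ (ranks l)))))
        (proj₂ (proj₂ (proj₂ (ranks k))) ≡.refl)
      where
      -- Each rank is stored with its value on and off `k`, the form in which `sum-support` is
      -- applied to the vector of ranks.
      ranks : ∀ l → ∃ λ r → Rank (single k x [ l ]) r × (l ≢ k → r ≡ 0) × (l ≡ k → r ≡ 1)
      ranks l with l Fin.≟ k
      ... | yes ≡.refl = 1 , single-rank≡ x≉0 , (λ l≢l → contradiction ≡.refl l≢l) , λ _ → ≡.refl
      ... | no  l≢k    = 0 , single-rank≢ l≢k , (λ _ → ≡.refl) , λ l≡k → contradiction l≡k l≢k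

    single∈ball₁ : ¬ x ≈ 0# → single k x ∈ Ball n 1
    single∈ball₁ x≉0 = upper , 1 , single-weight x≉0 , ℕ.≤-refl
      where
      upper : UpperTriangular (single k x)
      upper i j j<i = reflexive (single-off {k = k} {x} {i} {j} λ { (≡.refl , ≡.refl) → ℕ.<-irrefl ≡.refl j<i })

  0∈ball₁ : ∀ {n} → 0ᴹ ∈ Ball n 1
  0∈ball₁ {n} = (λ _ _ _ → refl) , 0 ,
    ((λ _ → 0) , (λ k → rank-zero (0ᴹ [ k ]) λ _ _ → refl) , ℕ-Sum.sum-replicate-zero n) , z≤n

  -- Coordinates of upper triangular matrices and the bound on the dimension.

  coordinates : ∀ n → Matrix n n → Vector Carrier (triangular n)
  coordinates zero    M = λ ()
  coordinates (suc n) M = M zero ++ coordinates n (λ i j → M (suc i) (suc j))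

  coordinates-injective : ∀ {n} {L M : Matrix n n} → (∀ x → coordinates n L x ≈ coordinates n M x) →
    ∀ i j → i Fin.≤ j → L i j ≈ M i j
  coordinates-injective {suc n} {L} {M} e zero j _ = Pointwise.++⁻ˡ _≈_ (L zero) (M zero) e j
  coordinates-injective {suc n} {L} {M} e (suc i) (suc j) (s≤s i≤j) =
    coordinates-injective (Pointwise.++⁻ʳ _≈_ (L zero) (M zero) e) i j i≤j

  outer : ∀ {l m} → Matrix l (2 + m) → Matrix l m
  outer M i j = M i (suc (suc j))

  -- For an upper triangular matrix these are the entries that remain once the three of the top-left
  -- 2 × 2 block are dropped, so the length is `triangular (2 + m)` minus 3.
  outerCoordinates : ∀ m → Matrix (2 + m) (2 + m) → Vector Carrier (m + (m + triangular m))
  outerCoordinates m M = outer M zero ++ outer M (suc zero) ++ coordinates m (λ i → outer M (suc (suc i)))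

  outerCoordinates-injective : ∀ {m} {L M : Matrix (2 + m) (2 + m)} → L ∈ UpperTriangular → M ∈ UpperTriangular →
    (∀ x → outerCoordinates m L x ≈ outerCoordinates m M x) → ∀ i j → outer L i j ≈ outer M i j
  outerCoordinates-injective {m} {L} {M} L-upper M-upper e = λ
    { zero          → Pointwise.++⁻ˡ _≈_ (outer L zero) (outer M zero) e
    ; (suc zero)    → Pointwise.++⁻ˡ _≈_ (outer L (suc zero)) (outer M (suc zero)) e'
    ; (suc (suc i)) j → case i Fin.≤? j of λ
      { (yes i≤j) → coordinates-injective (Pointwise.++⁻ʳ _≈_ (outer L (suc zero)) (outer M (suc zero)) e') i j i≤j
      -- Nothing is recorded below the diagonal, where both matrices vanish.
      ; (no  i≰j) → let j<i = s≤s (s≤s (ℕ.≰⇒> i≰j)) in trans (L-upper _ _ j<i) (sym (M-upper _ _ j<i))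
      }
    }
    where
    e' = Pointwise.++⁻ʳ _≈_ (outer L zero) (outer M zero) e

  weight₁≤1 : (A : Matrix 1 1) → ∃ λ w → FlagRankWeight A w × w ≤ 1
  weight₁≤1 A with r , rank , r≤1 ← row-rank≤1 (A [ zero ]) =
    r + 0 , ((λ _ → r) , (λ { zero → rank }) , ≡.refl) , ≡.subst (_≤ 1) (≡.sym (ℕ.+-identityʳ r)) r≤1

  -- Only the first two submatrices reach a column that may be nonzero. The first has a single row;
  -- in the second only the initial column survives. Each thus has rank at most 1.
  corner-weight≤2 : ∀ {m} (A : Matrix (2 + m) (2 + m)) → (∀ i j → outer A i j ≈ 0#) →
    ∃ λ w → FlagRankWeight A w × w ≤ 2
  corner-weight≤2 {m} A outer≈0 = weight
    where
    multiples : ∀ j → ∃ λ a → ∀ i → (A [ suc zero ]) i j ≈ a *ₖ (A [ suc zero ]) i zero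
    multiples zero    = 1# , λ _ → sym (*-identityˡ _)
    multiples (suc j) = 0# , λ _ → trans (outer≈0 _ _) (sym (zeroˡ _))
    weight : ∃ λ w → FlagRankWeight A w × w ≤ 2
    weight
      with r₀ , rank₀ , r₀≤1 ← row-rank≤1 (A [ zero ])
         | r₁ , rank₁ , r₁≤1 ← rank≤1 (A [ suc zero ]) zero multiples =
      r₀ + (r₁ + 0) ,
      (r₀ ∷ r₁ ∷ (λ _ → 0) , ranks , ≡.cong (λ s → r₀ + (r₁ + s)) (ℕ-Sum.sum-replicate-zero m)) ,
      ℕ.+-mono-≤ r₀≤1 (≡.subst (_≤ 1) (≡.sym (ℕ.+-identityʳ r₁)) r₁≤1)
      where
      ranks : ∀ k → Rank (A [ k ]) ((r₀ ∷ r₁ ∷ λ _ → 0) k)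
      ranks zero          = rank₀
      ranks (suc zero)    = rank₁
      ranks (suc (suc k)) = rank-zero (A [ suc (suc k) ]) λ _ _ → outer≈0 _ _

  3+dimension≤ : ∀ {n p d} (C : LinearCode n p) → 1 < q → 1 ≤ n → MinimumDistance C 3 →
    HasDimension (matrixSpace n n) (LinearCode.Member C) d → 3 + d ≤ triangular n
  -- For n = 1 every weight is at most 1, which excludes minimum distance 3.
  3+dimension≤ {1} C _ _ ((M , M∈C , M≉0 , _) , minimal) _ with w , weight , w≤1 ← weight₁≤1 M =
    contradiction (ℕ.≤-trans (minimal M M∈C M≉0 w weight) w≤1) λ { (s≤s ()) }
  3+dimension≤ {suc (suc m)} {d = d} C 1<q _ (_ , minimal) dimension = begin
    3 + d                           ≤⟨ ℕ.+-monoʳ-≤ 3 (dimension≤ subspace dimension 1<q (outerCoordinates m) separating) ⟩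
    3 + (m + (m + triangular m))    ≡⟨ regroup m (triangular m) ⟩
    triangular (suc (suc m))        ∎
    where
    open ℕ.≤-Reasoning
    open LinearCode C
    open LinearCombinations (matrixSpace (suc (suc m)) (suc (suc m)))
    open LinearCombinations (TensorUnit.leftModule {R = ring}) using () renaming (x≈y⇒x⊖y≈0 to x≈y⇒x⊖y≈0ₖ)
    regroup : ∀ a t → 3 + (a + (a + t)) ≡ suc (suc a) + (suc a + t)
    regroup = solve-∀
    separating : ∀ {L M} → L ∈ Member → M ∈ Member →
      (∀ x → outerCoordinates m L x ≈ outerCoordinates m M x) → ∀ i j → L i j ≈ M i j
    -- Equality of the entries is decidable, so it suffices to refute a nonzero difference, which
    -- would be a codeword of weight at most 2.
    separating {L} {M} L∈C M∈C e with all? (λ i → all? λ j → (L ⊖ M) i j ≈? 0#)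
    ... | yes L⊖M≈0 = x⊖y≈0⇒x≈y L⊖M≈0
    ... | no  L⊖M≉0 with w , weight , w≤2 ← corner-weight≤2 (L ⊖ M) (λ i j →
            x≈y⇒x⊖y≈0ₖ (outerCoordinates-injective (upperTriangular L∈C) (upperTriangular M∈C) e i j)) =
      contradiction (ℕ.≤-trans (minimal _ (+ᴹ-closed L∈C (*ₗ-closed _ M∈C)) L⊖M≉0 w weight) w≤2) λ { (s≤s (s≤s ())) }

-- The cardinality of the ball of radius one.

module _ {c ℓ₁ ℓ₂ r} (F : FiniteField c ℓ₁ ℓ₂ (suc r)) where
  open FiniteField F hiding (_+_; _*_; zero)
  open Inverse enumeration using (to; from; from-cong; strictlyInverseˡ; strictlyInverseʳ)
  open FiniteFieldProperties F
  open FlagRank F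

  private
    -- `punchIn (to 0#)` skips the index of zero, so the q - 1 nonzero scalars are enumerated.
    unit : Fin r → Carrier
    unit z = from (punchIn (to 0#) z)

    unit≉0 : ∀ z → ¬ unit z ≈ 0#
    unit≉0 z e = Fin.punchInᵢ≢i (to 0#) z (from-injective (trans e (sym (strictlyInverseʳ 0#))))

    unit-injective : ∀ {y z} → unit y ≈ unit z → y ≡ z
    unit-injective e = Fin.punchIn-injective (to 0#) _ _ (from-injective e)

    unit-surjective : ∀ {x} → ¬ x ≈ 0# → ∃ λ z → unit z ≈ x
    unit-surjective {x} x≉0 = punchOut 0≢x , trans (from-cong (Fin.punchIn-punchOut 0≢x)) (strictlyInverseʳ x)
      where
      0≢x : to 0# ≢ to x
      0≢x e = x≉0 (trans (sym (strictlyInverseʳ x)) (trans (from-cong (≡.sym e)) (strictlyInverseʳ 0#)))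

  -- Index 0 stands for the zero matrix; every other index encodes, through `remQuot`, a diagonal
  -- position and a nonzero scalar.
  ball₁-cardinality : ∀ n → HasCardinality matrixSetoid (Ball n 1) (1 + n * r)
  ball₁-cardinality n =
    enumerated⇒hasCardinality matrixSetoid (Ball n 1) element element∈ball (λ {i} {j} → injective i j) surjective
    where
    element : Fin (1 + n * r) → Matrix n n
    element zero    = 0ᴹ
    element (suc x) = let k , z = remQuot r x in single k (unit z)

    element∈ball : ∀ i → element i ∈ Ball n 1
    element∈ball zero    = 0∈ball₁
    element∈ball (suc x) = single∈ball₁ (unit≉0 (proj₂ (remQuot {n} r x)))

    single-injective : ∀ k y l z → (∀ i j → single k (unit y) i j ≈ single l (unit z) i j) → (k , y) ≡ (l , z)
    single-injective k y l z e with k Fin.≟ l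
    ... | yes ≡.refl = ≡.cong (k ,_) (unit-injective (trans y≈entry (reflexive (single-at k (unit z)))))
      where y≈entry = trans (reflexive (≡.sym (single-at k (unit y)))) (e k k)
    ... | no  k≢l    = contradiction (trans y≈entry (reflexive (single-off (k≢l ∘ proj₁)))) (unit≉0 y)
      where y≈entry = trans (reflexive (≡.sym (single-at k (unit y)))) (e k k)

    single≉0 : ∀ k z → ¬ (∀ i j → single k (unit z) i j ≈ 0#)
    single≉0 k z e = unit≉0 z (trans (reflexive (≡.sym (single-at k (unit z)))) (e k k))

    injective : ∀ i j → (∀ x y → element i x y ≈ element j x y) → i ≡ j
    injective zero    zero    e = ≡.refl
    injective zero    (suc j) e = contradiction (λ x y → sym (e x y)) (single≉0 _ _)
    injective (suc i) zero    e = contradiction e (single≉0 _ _)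
    injective (suc i) (suc j) e = ≡.cong suc (≡.trans (≡.sym (Fin.combine-remQuot {n} r i))
      (≡.trans (≡.cong (λ (k , z) → combine k z) (single-injective _ _ _ _ e)) (Fin.combine-remQuot {n} r j)))

    surjective : ∀ {A} → A ∈ Ball n 1 → ∃ λ i → ∀ x y → element i x y ≈ A x y
    -- A vanishing diagonal leaves only the zero matrix. Otherwise a nonzero entry at `k` determines
    -- the index, since all other entries vanish.
    surjective {A} A∈ball with any? (λ k → ¬? (A k k ≈? 0#))
    ... | no ∄k = zero , λ x y → sym (A≈0 x y)
      where
      A≈0 : ∀ x y → A x y ≈ 0#
      A≈0 x y with x Fin.≟ y
      ... | yes ≡.refl = decidable-stable (A x x ≈? 0#) λ ne → ∄k (x , ne)
      ... | no  x≢y    = ball₁-diagonal A∈ball x≢y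
    ... | yes (k , Aₖₖ≉0) with z , z↦Aₖₖ ← unit-surjective Aₖₖ≉0 = suc (combine k z) , agrees
      where
      element≡single : element (suc (combine k z)) ≡ single k (unit z)
      element≡single = ≡.cong (λ (k , z) → single k (unit z)) (Fin.remQuot-combine k z)
      single≈A : ∀ x y → single k (unit z) x y ≈ A x y
      single≈A x y with x Fin.≟ k ×-dec y Fin.≟ k
      ... | yes (≡.refl , ≡.refl) = z↦Aₖₖ
      ... | no  off               = sym (A-off (x Fin.≟ y))
        where
        A-off : Dec (x ≡ y) → A x y ≈ 0#
        A-off (no  x≢y)    = ball₁-diagonal A∈ball x≢y
        A-off (yes ≡.refl) = decidable-stable (A x x ≈? 0#) λ Aₓₓ≉0 →
          let x≡k = ball₁-support-unique A∈ball Aₓₓ≉0 Aₖₖ≉0 in off (x≡k , x≡k)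
      agrees : ∀ x y → element (suc (combine k z)) x y ≈ A x y
      agrees x y = trans (reflexive (≡.cong (λ M → M x y) element≡single)) (single≈A x y)

theorem5p4 : ∀ {c ℓ₁ ℓ₂ p : Level} (n : ℕ) → 1 ≤ n →
    (q : ℕ) (q-primePower : IsPrimePower q) (F : FiniteField c ℓ₁ ℓ₂ q) →
    let open FlagRank F in
    (C : LinearCode n p) (α : ℕ) → MinimumDistance C 3 → Codimension C α →
    (Perfect C ⇔ n ≡ _/_ (q ^ α ∸ 1) (q ∸ 1) {{primePower⇒q∸1-nonZero q-primePower}}) × 3 ≤ α
-- That `q ∸ 1` is nonzero excludes q = 0; for q = `suc r` it computes to `r`, the form used in
-- `perfect-arithmetic`.
theorem5p4 n 1≤n zero q-primePower = contradiction ≡.refl (ℕ.≢-nonZero⁻¹ 0 {{primePower⇒q∸1-nonZero q-primePower}})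
theorem5p4 n 1≤n q@(suc r) q-primePower F C α minDistance@((M , M∈C , M≉0 , weight) , minimal) (d , dimension , α≡) =
  mk⇔ (Equivalence.to arithmetic ∘ perfect⇒) (perfect⇐ ∘ Equivalence.from arithmetic) , 3≤α
  where
  open FlagRank F
  open LinearCode C using (Member; subspace)
  open ≡-Reasoning
  instance
    r≢0 : NonZero r
    r≢0 = primePower⇒q∸1-nonZero q-primePower
    qᵈ≢0 : NonZero (q ^ d)
    qᵈ≢0 = ℕ.m^n≢0 q d

  N = n * suc n / 2

  3+d≤N : 3 + d ≤ N
  3+d≤N = ≡.subst (3 + d ≤_) (triangular≡n[1+n]/2 n)
    (FiniteFieldProperties.3+dimension≤ F C (s≤s (ℕ.>-nonZero⁻¹ r)) 1≤n minDistance dimension)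

  3≤α : 3 ≤ α
  3≤α = ≡.subst (3 ≤_) (≡.sym α≡) (ℕ.m+n≤o⇒m≤o∸n 3 3+d≤N)

  -- By `3+d≤N` the subtraction `N ∸ d` does not truncate, so d + α = N.
  qᵈ*qᵅ≡qᴺ : q ^ d * q ^ α ≡ q ^ N
  qᵈ*qᵅ≡qᴺ = begin
    q ^ d * q ^ α          ≡⟨ ℕ.^-distribˡ-+-* q d α ⟨
    q ^ (d + α)            ≡⟨ ≡.cong (λ a → q ^ (d + a)) α≡ ⟩
    q ^ (d + (N ∸ d))      ≡⟨ ≡.cong (q ^_) (ℕ.m+[n∸m]≡n (ℕ.m+n≤o⇒n≤o 3 3+d≤N)) ⟩
    q ^ N                  ∎

  arithmetic : 1 + n * r ≡ q ^ α ⇔ n ≡ (q ^ α ∸ 1) / r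
  arithmetic = perfect-arithmetic n r α

  |C|≡qᵈ : HasCardinality matrixSetoid Member (q ^ d)
  |C|≡qᵈ = FiniteFieldProperties.dimension⇒cardinality F subspace dimension

  perfect⇐ : 1 + n * r ≡ q ^ α → Perfect C
  perfect⇐ e = 3 , q ^ d , 1 + n * r , minDistance , |C|≡qᵈ , ball₁-cardinality F n ,
    ≡.trans (≡.cong (q ^ d *_) e) qᵈ*qᵅ≡qᴺ

  perfect⇒ : Perfect C → 1 + n * r ≡ q ^ α
  perfect⇒ (δ , k , b , ((M' , M'∈C , M'≉0 , weight') , minimal') , |C|≡k , |ball|≡b , k*b≡qᴺ)
    -- `Perfect` brings its own δ. Each minimum distance bounds the weight of the other's witness,
    -- so δ = 3 and the radius `(δ ∸ 1) / 2` computes to 1.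
    with ≡.refl ← ℕ.≤-antisym (minimal' M M∈C M≉0 3 weight) (minimal M' M'∈C M'≉0 δ weight') =
    ℕ.*-cancelˡ-≡ _ _ (q ^ d) (begin
      q ^ d * (1 + n * r)    ≡⟨ ≡.cong₂ _*_
                                  (hasCardinality-unique matrixSetoid Member |C|≡qᵈ |C|≡k)
                                  (hasCardinality-unique matrixSetoid (Ball n 1) (ball₁-cardinality F n) |ball|≡b) ⟩
      k * b                  ≡⟨ k*b≡qᴺ ⟩
      q ^ N                  ≡⟨ qᵈ*qᵅ≡qᴺ ⟨
      q ^ d * q ^ α          ∎)
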